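{- Let $m,k$ be integers with $4>m>k\ge 1$, let $a\in\mathbb{Q}$, and let $f_{4,m,k}(a,x)=x^4+x^m+x^k+a$. Then $f_{4,m,k}(a,x)$ has a quadratic factor over $\mathbb{Q}$ precisely in the following cases (where $p,q\in\mathbb{Q}$): (1) If $(m,k)=(2,1)$, then $f_{4,2,1}(a,x)$ is divisible by $x^2+px+q$ if and only if $p\neq 0$ and $$a=\frac{(p^3+p-1)(p^3+p+1)}{4p^2},\qquad q=\frac{p^3+p-1}{2p}.$$ In this case $$f_{4,2,1}(a,x)=\left(x^2-px+\frac{p^3+p+1}{2p}\right)\left(x^2+px+\frac{p^3+p-1}{2p}\right).$$ (2) If $(m,k)=(3,1)$, then $f_{4,3,1}(a,x)$ is divisible by $x^2+px+q$ if and only if $p\ne \frac12$ and $$a=\frac{(p^3-2p^2+p+1)(p^3-p^2-1)}{(2p-1)^2},\qquad q=\frac{p^3-p^2-1}{2p-1}.$$ In this case $$f_{4,3,1}(a,x)=\left(x^2-(p-1)x+\frac{p^3-2p^2+p+1}{2p-1}\right)\left(x^2+px+\frac{p^3-p^2-1}{2p-1}\right).$$ (3) If $(m,k)=(3,2)$, then $f_{4,3,2}(a,x)$ is divisible by $x^2+px+q$ if and only if $p\neq\frac12$ and $$a=\frac{(p-1)p(p^2-p+1)^2}{(2p-1)^2},\qquad q=\frac{p(p^2-p+1)}{2p-1}.$$ In this case $$f_{4,3,2}(a,x)=\left(x^2-(p-1)x+\frac{(p-1)(p^2-p+1)}{2p-1}\right)\left(x^2+px+\frac{p(p^2-p+1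)}{2p-1}\right).$$
   Context: All polynomials have rational coefficients, and divisibility and factorization are over $\mathbb{Q}$. -}

module Defs where

open import Algebra.Bundles.Raw using (RawSemiring)
import Algebra.Definitions.RawSemiring as RawSemiringDefinitions
open import Data.Integer.Base using (+_)
open import Data.List.Base using (List; []; _∷_; map)
open import Data.Nat.Base as ℕ using (ℕ; zero; suc)
open import Data.Product.Base using (Σ-syntax; ∃; _×_)
open import Data.Rational.Base
  using (ℚ; 0ℚ; 1ℚ; ½; _+_; _*_; _-_; _÷_; _/_; 1/_; NonZero; ≢-nonZero)
open import Data.Rational.Properties
  using (*-assoc; *-identityˡ; *-inverseˡ; *-zeroʳ; +-*-rawSemiring)
open import Data.Rational.Solver using (module +-*-Solver)
open import Level using (0ℓ)
open import Relation.Binary.PropositionalEquality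
  using (_≡_; _≢_; refl; cong; module ≡-Reasoning)

open RawSemiringDefinitions +-*-rawSemiring public using (_^_)

2ℚ 4ℚ : ℚ
2ℚ = + 2 / 1
4ℚ = + 4 / 1

-- Coefficients are listed from the constant term upwards, and trailing
-- zeros are allowed, so polynomials are compared with _≈_ rather than _≡_.

ℚ[X] : Set
ℚ[X] = List ℚ

coeff : ℚ[X] → ℕ → ℚ
coeff []      _       = 0ℚ
coeff (c ∷ P) zero    = c
coeff (c ∷ P) (suc i) = coeff P i

infix 4 _≈_
_≈_ : ℚ[X] → ℚ[X] → Set
P ≈ Q = ∀ i → coeff P i ≡ coeff Q i

infixl 6 _⊕_
_⊕_ : ℚ[X] → ℚ[X] → ℚ[X]
[]      ⊕ Q       = Q
(c ∷ P) ⊕ []      = c ∷ P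
(c ∷ P) ⊕ (d ∷ Q) = (c + d) ∷ (P ⊕ Q)

-- (c + X P) Q = c Q + X (P Q)

infixl 7 _⊗_
_⊗_ : ℚ[X] → ℚ[X] → ℚ[X]
[]      ⊗ Q = []
(c ∷ P) ⊗ Q = map (c *_) Q ⊕ (0ℚ ∷ (P ⊗ Q))

C : ℚ → ℚ[X]
C c = c ∷ []

X : ℚ[X]
X = 0ℚ ∷ 1ℚ ∷ []

ℚ[X]-rawSemiring : RawSemiring 0ℓ 0ℓ
ℚ[X]-rawSemiring = record
  { Carrier = ℚ[X]
  ; _≈_     = _≈_
  ; _+_     = _⊕_
  ; _*_     = _⊗_
  ; 0#      = []
  ; 1#      = C 1ℚ
  }

open RawSemiringDefinitions ℚ[X]-rawSemiring public
  using (_∣_)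
  renaming (_^_ to _^ₚ_)

HasDegree : ℚ[X] → ℕ → Set
HasDegree P n = coeff P n ≢ 0ℚ × (∀ i → i ℕ.> n → coeff P i ≡ 0ℚ)

-- The factor need be neither monic nor irreducible.

HasQuadraticFactor : ℚ[X] → Set
HasQuadraticFactor P = ∃ λ g → HasDegree g 2 × g ∣ P

infix 8 X²+_X+_
X²+_X+_ : ℚ → ℚ → ℚ[X]
X²+ p X+ q = X ^ₚ 2 ⊕ C p ⊗ X ⊕ C q

f : (n m k : ℕ) → ℚ → ℚ[X]
f n m k a = X ^ₚ n ⊕ X ^ₚ m ⊕ X ^ₚ k ⊕ C a

*-≢0 : ∀ {x y} → x ≢ 0ℚ → y ≢ 0ℚ → x * y ≢ 0ℚ
*-≢0 {x} {y} x≢0 y≢0 xy≡0 = y≢0 (begin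
  y               ≡⟨ *-identityˡ y ⟨
  1ℚ * y          ≡⟨ cong (_* y) (*-inverseˡ x) ⟨
  1/ x * x * y    ≡⟨ *-assoc (1/ x) x y ⟩
  1/ x * (x * y)  ≡⟨ cong (1/ x *_) xy≡0 ⟩
  1/ x * 0ℚ       ≡⟨ *-zeroʳ (1/ x) ⟩
  0ℚ              ∎)
  where
  open ≡-Reasoning
  instance _ = ≢-nonZero x≢0

^2-≢0 : ∀ {x} → x ≢ 0ℚ → x ^ 2 ≢ 0ℚ
^2-≢0 x≢0 = *-≢0 x≢0 (*-≢0 x≢0 λ ())

2p-1≢0 : ∀ {p} → p ≢ ½ → 2ℚ * p - 1ℚ ≢ 0ℚ
2p-1≢0 {p} p≢½ eq = p≢½ (begin
  p                          ≡⟨ lemma p ⟩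
  ½ * (2ℚ * p - 1ℚ) + ½      ≡⟨ cong (λ z → ½ * z + ½) eq ⟩
  ½ * 0ℚ + ½                 ∎)
  where
  open ≡-Reasoning
  open +-*-Solver
  lemma : ∀ p → p ≡ ½ * (2ℚ * p - 1ℚ) + ½
  lemma = solve 1 (λ p → p := con ½ :* (con 2ℚ :* p :- con 1ℚ) :+ con ½) refl

module _ {p : ℚ} where

  2p-nonZero : p ≢ 0ℚ → NonZero (2ℚ * p)
  2p-nonZero p≢0 = ≢-nonZero (*-≢0 {2ℚ} (λ ()) p≢0)

  4p²-nonZero : p ≢ 0ℚ → NonZero (4ℚ * p ^ 2)
  4p²-nonZero p≢0 = ≢-nonZero (*-≢0 {4ℚ} (λ ()) (^2-≢0 p≢0))

  2p-1-nonZero : p ≢ ½ → NonZero (2ℚ * p - 1ℚ)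
  2p-1-nonZero p≢½ = ≢-nonZero (2p-1≢0 p≢½)

  [2p-1]²-nonZero : p ≢ ½ → NonZero ((2ℚ * p - 1ℚ) ^ 2)
  [2p-1]²-nonZero p≢½ = ≢-nonZero (^2-≢0 (2p-1≢0 p≢½))

-- The conditions on a, p and q for (m , k) = (2 , 1), (3 , 1) and (3 , 2).

Condition₂₁ : (a p q : ℚ) → Set
Condition₂₁ a p q = Σ[ p≢0 ∈ p ≢ 0ℚ ]
  let instance
        _ = 2p-nonZero p≢0
        _ = 4p²-nonZero p≢0
  in  a ≡ ((p ^ 3 + p - 1ℚ) * (p ^ 3 + p + 1ℚ)) ÷ (4ℚ * p ^ 2)
    × q ≡ (p ^ 3 + p - 1ℚ) ÷ (2ℚ * p)

Condition₃₁ : (a p q : ℚ) → Set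
Condition₃₁ a p q = Σ[ p≢½ ∈ p ≢ ½ ]
  let instance
        _ = 2p-1-nonZero p≢½
        _ = [2p-1]²-nonZero p≢½
  in  a ≡ ((p ^ 3 - 2ℚ * p ^ 2 + p + 1ℚ) * (p ^ 3 - p ^ 2 - 1ℚ)) ÷ ((2ℚ * p - 1ℚ) ^ 2)
    × q ≡ (p ^ 3 - p ^ 2 - 1ℚ) ÷ (2ℚ * p - 1ℚ)

Condition₃₂ : (a p q : ℚ) → Set
Condition₃₂ a p q = Σ[ p≢½ ∈ p ≢ ½ ]
  let instance
        _ = 2p-1-nonZero p≢½
        _ = [2p-1]²-nonZero p≢½
  in  a ≡ ((p - 1ℚ) * p * (p ^ 2 - p + 1ℚ) ^ 2) ÷ ((2ℚ * p - 1ℚ) ^ 2)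
    × q ≡ (p * (p ^ 2 - p + 1ℚ)) ÷ (2ℚ * p - 1ℚ)

{-# OPTIONS --safe #-}

-- A factorisation x⁴ + b x³ + c x² + d x + a = (x² + r x + s)(x² + p x + q) means
-- p + r = b, q + s + p r = c, p s + q r = d and q s = a.  Eliminating s gives
-- q (p − r) = p c − p² r − d with r = b − p, so p determines q, s and hence a
-- unless p − r = 0, in which case the right-hand side would have to vanish too;
-- for the three quartics of the theorem it does not.

module Submission where

open import Defs
open import Algebra.Bundles.Raw using (RawSemiring)
open import Algebra.Definitions.RawMagma (RawSemiring.*-rawMagma ℚ[X]-rawSemiring) using (_,_)
open import Data.List.Base using ([]; _∷_; map)
open import Data.Nat.Base as ℕ using (ℕ; zero; suc; _>_; _≥_; z≤n; s≤s)
import Data.Nat.Properties as ℕₚ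
open import Data.Product.Base using (_×_; _,_; ∃₂; proj₁; proj₂)
open import Data.Rational.Base
  using (ℚ; 0ℚ; 1ℚ; ½; _+_; _*_; _-_; -_; _÷_; 1/_; NonZero)
open import Data.Rational.Properties
  using ( _≟_; +-comm; +-identityˡ; +-identityʳ; +-inverseʳ; +-0-group
        ; *-assoc; *-comm; *-identityˡ; *-identityʳ; *-zeroˡ; *-zeroʳ; *-inverseˡ; *-inverseʳ)
open import Algebra.Properties.Group +-0-group using (∙-cancelˡ)
open import Data.Rational.Solver using (module +-*-Solver)
open import Data.Sum.Base using (_⊎_; inj₁; inj₂)
open import Function.Bundles using (_⇔_; mk⇔; Equivalence)
open import Function.Construct.Composition using (_⇔-∘_)
open import Relation.Binary.PropositionalEquality
  using (_≡_; _≢_; refl; sym; trans; cong; cong₂; subst; subst₂; module ≡-Reasoning)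
open import Relation.Nullary using (yes; no; contradiction)

open +-*-Solver
open ≡-Reasoning

-- Coefficients of sums and products.

≡⇒≈ : ∀ {P Q} → P ≡ Q → P ≈ Q
≡⇒≈ refl _ = refl

tail : ℚ[X] → ℚ[X]
tail []      = []
tail (_ ∷ P) = P

coeff-⊕ : ∀ P Q i → coeff (P ⊕ Q) i ≡ coeff P i + coeff Q i
coeff-⊕ []      Q       i       = sym (+-identityˡ _)
coeff-⊕ (c ∷ P) []      i       = sym (+-identityʳ _)
coeff-⊕ (c ∷ P) (d ∷ Q) zero    = refl
coeff-⊕ (c ∷ P) (d ∷ Q) (suc i) = coeff-⊕ P Q i

coeff-map : ∀ c P i → coeff (map (c *_) P) i ≡ c * coeff P i
coeff-map c []      i       = sym (*-zeroʳ c)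
coeff-map c (_ ∷ P) zero    = refl
coeff-map c (_ ∷ P) (suc i) = coeff-map c P i

coeff-⊗-zero : ∀ P Q → coeff (P ⊗ Q) 0 ≡ coeff P 0 * coeff Q 0
coeff-⊗-zero []      Q = sym (*-zeroˡ (coeff Q 0))
coeff-⊗-zero (c ∷ P) Q = begin
  coeff (map (c *_) Q ⊕ (0ℚ ∷ (P ⊗ Q))) 0  ≡⟨ coeff-⊕ (map (c *_) Q) _ 0 ⟩
  coeff (map (c *_) Q) 0 + 0ℚ              ≡⟨ +-identityʳ _ ⟩
  coeff (map (c *_) Q) 0                   ≡⟨ coeff-map c Q 0 ⟩
  c * coeff Q 0                            ∎

-- Phrased with `coeff P 0` and `tail P` instead of a cons, so that it applies to a cofactor of
-- unknown length, even an empty list.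
coeff-⊗-suc : ∀ P Q i →
  coeff (P ⊗ Q) (suc i) ≡ coeff P 0 * coeff Q (suc i) + coeff (tail P ⊗ Q) i
coeff-⊗-suc []      Q i = sym (trans (+-identityʳ _) (*-zeroˡ (coeff Q (suc i))))
coeff-⊗-suc (c ∷ P) Q i = begin
  coeff (map (c *_) Q ⊕ (0ℚ ∷ (P ⊗ Q))) (suc i)   ≡⟨ coeff-⊕ (map (c *_) Q) _ (suc i) ⟩
  coeff (map (c *_) Q) (suc i) + coeff (P ⊗ Q) i  ≡⟨ cong (_+ coeff (P ⊗ Q) i) (coeff-map c Q (suc i)) ⟩
  c * coeff Q (suc i) + coeff (P ⊗ Q) i           ∎

-- Above the degree of `Q` the lowest coefficient of `P` no longer contributes, so one may pass to
-- the tail of `P` and lower the index by one.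
coeff-⊗-suc-zero : ∀ P Q i → coeff Q (suc i) ≡ 0ℚ →
  coeff (P ⊗ Q) (suc i) ≡ coeff (tail P ⊗ Q) i
coeff-⊗-suc-zero P Q i Qᵢ≡0 = begin
  coeff (P ⊗ Q) (suc i)                                ≡⟨ coeff-⊗-suc P Q i ⟩
  coeff P 0 * coeff Q (suc i) + coeff (tail P ⊗ Q) i   ≡⟨ cong (λ z → coeff P 0 * z + coeff (tail P ⊗ Q) i) Qᵢ≡0 ⟩
  coeff P 0 * 0ℚ + coeff (tail P ⊗ Q) i                ≡⟨ cong (_+ coeff (tail P ⊗ Q) i) (*-zeroʳ (coeff P 0)) ⟩
  0ℚ + coeff (tail P ⊗ Q) i                            ≡⟨ +-identityˡ _ ⟩
  coeff (tail P ⊗ Q) i                                 ∎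

⊗-zeroˡ : ∀ {P} Q → P ≈ [] → P ⊗ Q ≈ []
⊗-zeroˡ {[]}    Q P≈0 i       = refl
⊗-zeroˡ {c ∷ P} Q P≈0 zero    = begin
  coeff ((c ∷ P) ⊗ Q) 0  ≡⟨ coeff-⊗-zero (c ∷ P) Q ⟩
  c * coeff Q 0          ≡⟨ cong (_* coeff Q 0) (P≈0 0) ⟩
  0ℚ * coeff Q 0         ≡⟨ *-zeroˡ (coeff Q 0) ⟩
  0ℚ                     ∎
⊗-zeroˡ {c ∷ P} Q P≈0 (suc i) = begin
  coeff ((c ∷ P) ⊗ Q) (suc i)            ≡⟨ coeff-⊗-suc (c ∷ P) Q i ⟩
  c * coeff Q (suc i) + coeff (P ⊗ Q) i  ≡⟨ cong₂ (λ x y → x * coeff Q (suc i) + y) (P≈0 0) (⊗-zeroˡ {P} Q (λ j → P≈0 (suc j)) i) ⟩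
  0ℚ * coeff Q (suc i) + 0ℚ              ≡⟨ +-identityʳ _ ⟩
  0ℚ * coeff Q (suc i)                   ≡⟨ *-zeroˡ (coeff Q (suc i)) ⟩
  0ℚ                                     ∎

-- Induction on the list `h`, from its high end, since trailing zeros make its length useless as a
-- degree. Shifting the index shows that the tail inherits the hypothesis, hence vanishes;
-- coefficient `n` of the product is then the head times the nonzero leading coefficient of `g`.
cofactor-≈0 : ∀ {g} n → HasDegree g n → ∀ h →
  (∀ i → i ℕ.≥ n → coeff (h ⊗ g) i ≡ 0ℚ) → h ≈ []
cofactor-≈0 n deg []      hg≡0 = λ _ → refl
cofactor-≈0 {g} n deg@(gₙ≢0 , g>n≡0) (c ∷ h) hg≡0 = λ where
    zero    → c≡0 n refl
    (suc i) → h≈0 i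
  where
  h≈0 : h ≈ []
  h≈0 = cofactor-≈0 n deg h λ i i≥n →
    trans (sym (coeff-⊗-suc-zero (c ∷ h) g i (g>n≡0 (suc i) (s≤s i≥n))))
          (hg≡0 (suc i) (ℕₚ.m≤n⇒m≤1+n i≥n))
  -- The case split on `n` goes through a copy `k`, because coefficient 0 and the later coefficients
  -- of a product obey different rules.
  c*gₙ≡0 : ∀ k → k ≡ n → c * coeff g k ≡ 0ℚ
  c*gₙ≡0 zero    refl = trans (sym (coeff-⊗-zero (c ∷ h) g)) (hg≡0 0 z≤n)
  c*gₙ≡0 (suc k) refl = begin
    c * coeff g n                      ≡⟨ +-identityʳ _ ⟨
    c * coeff g n + 0ℚ                 ≡⟨ cong (c * coeff g n +_) (⊗-zeroˡ {h} g h≈0 k) ⟨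
    c * coeff g n + coeff (h ⊗ g) k    ≡⟨ coeff-⊗-suc (c ∷ h) g k ⟨
    coeff ((c ∷ h) ⊗ g) n              ≡⟨ hg≡0 n ℕₚ.≤-refl ⟩
    0ℚ                                 ∎
  c≡0 : ∀ k → k ≡ n → c ≡ 0ℚ
  c≡0 k k≡n with c ≟ 0ℚ
  ... | yes eq = eq
  ... | no neq = contradiction (c*gₙ≡0 k k≡n) (*-≢0 neq (subst (λ j → coeff g j ≢ 0ℚ) (sym k≡n) gₙ≢0))

-- Factorizations into quadratics as equations between coefficients.

monic₂ : (p q : ℚ) → ℚ[X]
monic₂ p q = q ∷ p ∷ 1ℚ ∷ []

quartic : (b c d a : ℚ) → ℚ[X]
quartic b c d a = a ∷ d ∷ c ∷ b ∷ 1ℚ ∷ []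

-- The two sides agree as lists, not merely up to `_≈_`, so later proofs can transport along this
-- equation.
X²+pX+q≡ : ∀ p q → X²+ p X+ q ≡ monic₂ p q
X²+pX+q≡ p q = cong₂ (λ u v → u ∷ v ∷ 1ℚ ∷ [])
  (solve 2 (λ p q → con 0ℚ :+ (p :* con 0ℚ :+ con 0ℚ) :+ q := q) refl p q)
  (solve 1 (λ p → con 0ℚ :+ p :* con 1ℚ := p) refl p)

-- With numeral exponents the powers of `X` evaluate, leaving only the constant term `0ℚ + a` to
-- simplify; likewise for the next two quartics.
f₂₁≡ : ∀ a → f 4 2 1 a ≡ quartic 0ℚ 1ℚ 1ℚ a
f₂₁≡ a = cong (_∷ _) (+-identityˡ a)

f₃₁≡ : ∀ a → f 4 3 1 a ≡ quartic 1ℚ 0ℚ 1ℚ a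
f₃₁≡ a = cong (_∷ _) (+-identityˡ a)

f₃₂≡ : ∀ a → f 4 3 2 a ≡ quartic 1ℚ 1ℚ 0ℚ a
f₃₂≡ a = cong (_∷ _) (+-identityˡ a)

record IsFactorisation (b c d a p q r s : ℚ) : Set where
  constructor isFactorisation
  field
    cubic     : p + r ≡ b
    quadratic : q + s + p * r ≡ c
    linear    : p * s + q * r ≡ d
    constant  : q * s ≡ a

quartic-cong : ∀ {a a′ b b′ c c′ d d′ e} → a ≡ a′ → d ≡ d′ → c ≡ c′ → b ≡ b′ → e ≡ 1ℚ →
  (a ∷ d ∷ c ∷ b ∷ e ∷ []) ≡ quartic b′ c′ d′ a′
quartic-cong refl refl refl refl refl = refl

⊗-monic₂ : ∀ {b c d a p q r s} → IsFactorisation b c d a p q r s →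
  (X²+ r X+ s) ⊗ (X²+ p X+ q) ≡ quartic b c d a
⊗-monic₂ {p = p} {q} {r} {s} (isFactorisation cubic quadratic linear constant) =
  trans (cong₂ _⊗_ (X²+pX+q≡ r s) (X²+pX+q≡ p q)) (quartic-cong
    (trans (solve 2 (λ q s → s :* q :+ con 0ℚ := q :* s) refl q s) constant)
    (trans (solve 4 (λ p q r s → s :* p :+ (r :* q :+ con 0ℚ) := p :* s :+ q :* r) refl p q r s) linear)
    (trans (solve 4 (λ p q r s → s :* con 1ℚ :+ (r :* p :+ (con 1ℚ :* q :+ con 0ℚ)) := q :+ s :+ p :* r) refl p q r s) quadratic)
    (trans (solve 2 (λ p r → r :* con 1ℚ :+ con 1ℚ :* p := p :+ r) refl p r) cubic)
    refl)

X²+pX+q-hasDegree : ∀ p q → HasDegree (X²+ p X+ q) 2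
X²+pX+q-hasDegree p q = subst (λ P → HasDegree P 2) (sym (X²+pX+q≡ p q))
  ((λ ()) , λ where (suc (suc (suc i))) (s≤s (s≤s (s≤s _))) → refl)

-- Normalising g to be monic multiplies it by the leading coefficient of the cofactor h.
quadraticFactor⇒isFactorisation : ∀ {b c d a} g h → HasDegree g 2 → h ⊗ g ≈ quartic b c d a →
  let g₀ = coeff g 0
      g₁ = coeff g 1
      g₂ = coeff g 2
      h₀ = coeff h 0
      h₁ = coeff (tail h) 0
      h₂ = coeff (tail (tail h)) 0
  in  h₂ * g₂ ≡ 1ℚ × IsFactorisation b c d a (h₂ * g₁) (h₂ * g₀) (h₁ * g₂) (h₀ * g₂)
quadraticFactor⇒isFactorisation {b} {c} {d} {a} g h g-deg@(_ , g>2≡0) hg≈ =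
  h₂g₂≡1 , isFactorisation (trans (+-comm (h₂ * g₁) (h₁ * g₂)) h₁g₂+h₂g₁≡b) quadratic linear constant
  where
  h′ = tail h
  h″ = tail h′
  h‴ = tail h″
  g₀ = coeff g 0
  g₁ = coeff g 1
  g₂ = coeff g 2
  h₀ = coeff h 0
  h₁ = coeff h′ 0
  h₂ = coeff h″ 0

  shift : ∀ P i → coeff (P ⊗ g) (3 ℕ.+ i) ≡ coeff (tail P ⊗ g) (2 ℕ.+ i)
  shift P i = coeff-⊗-suc-zero P g (2 ℕ.+ i) (g>2≡0 (3 ℕ.+ i) (s≤s (s≤s (s≤s z≤n))))

  h‴≈0 : h‴ ≈ []
  -- Three shifts identify coefficient `2 + i` of `h‴ ⊗ g` with coefficient `5 + i` of `h ⊗ g`,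
  -- which lies above the degree of the quartic.
  h‴≈0 = cofactor-≈0 2 g-deg h‴ λ where
    (suc (suc i)) _ → begin
      coeff (h‴ ⊗ g) (2 ℕ.+ i)  ≡⟨ shift h″ i ⟨
      coeff (h″ ⊗ g) (3 ℕ.+ i)  ≡⟨ shift h′ (1 ℕ.+ i) ⟨
      coeff (h′ ⊗ g) (4 ℕ.+ i)  ≡⟨ shift h (2 ℕ.+ i) ⟨
      coeff (h ⊗ g) (5 ℕ.+ i)   ≡⟨ hg≈ (5 ℕ.+ i) ⟩
      0ℚ                        ∎
    1 (s≤s ())

  h‴g≈0 : h‴ ⊗ g ≈ []
  h‴g≈0 = ⊗-zeroˡ {h‴} g h‴≈0

  h″g : ∀ i → coeff (h″ ⊗ g) (suc i) ≡ h₂ * coeff g (suc i)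
  h″g i = begin
    coeff (h″ ⊗ g) (suc i)                       ≡⟨ coeff-⊗-suc h″ g i ⟩
    h₂ * coeff g (suc i) + coeff (h‴ ⊗ g) i      ≡⟨ cong (h₂ * coeff g (suc i) +_) (h‴g≈0 i) ⟩
    h₂ * coeff g (suc i) + 0ℚ                    ≡⟨ +-identityʳ _ ⟩
    h₂ * coeff g (suc i)                         ∎

  h₀g₀≡a : h₀ * g₀ ≡ a
  h₀g₀≡a = trans (sym (coeff-⊗-zero h g)) (hg≈ 0)

  h₀g₁+h₁g₀≡d : h₀ * g₁ + h₁ * g₀ ≡ d
  h₀g₁+h₁g₀≡d = begin
    h₀ * g₁ + h₁ * g₀            ≡⟨ cong (h₀ * g₁ +_) (coeff-⊗-zero h′ g) ⟨
    h₀ * g₁ + coeff (h′ ⊗ g) 0   ≡⟨ coeff-⊗-suc h g 0 ⟨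
    coeff (h ⊗ g) 1              ≡⟨ hg≈ 1 ⟩
    d                            ∎

  h₀g₂+h₁g₁+h₂g₀≡c : h₀ * g₂ + (h₁ * g₁ + h₂ * g₀) ≡ c
  h₀g₂+h₁g₁+h₂g₀≡c = begin
    h₀ * g₂ + (h₁ * g₁ + h₂ * g₀)           ≡⟨ cong (λ z → h₀ * g₂ + (h₁ * g₁ + z)) (coeff-⊗-zero h″ g) ⟨
    h₀ * g₂ + (h₁ * g₁ + coeff (h″ ⊗ g) 0)  ≡⟨ cong (h₀ * g₂ +_) (coeff-⊗-suc h′ g 0) ⟨
    h₀ * g₂ + coeff (h′ ⊗ g) 1              ≡⟨ coeff-⊗-suc h g 1 ⟨
    coeff (h ⊗ g) 2                         ≡⟨ hg≈ 2 ⟩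
    c                                       ∎

  h₁g₂+h₂g₁≡b : h₁ * g₂ + h₂ * g₁ ≡ b
  h₁g₂+h₂g₁≡b = begin
    h₁ * g₂ + h₂ * g₁            ≡⟨ cong (h₁ * g₂ +_) (h″g 0) ⟨
    h₁ * g₂ + coeff (h″ ⊗ g) 1   ≡⟨ coeff-⊗-suc h′ g 1 ⟨
    coeff (h′ ⊗ g) 2             ≡⟨ shift h 0 ⟨
    coeff (h ⊗ g) 3              ≡⟨ hg≈ 3 ⟩
    b                            ∎

  h₂g₂≡1 : h₂ * g₂ ≡ 1ℚ
  h₂g₂≡1 = begin
    h₂ * g₂           ≡⟨ h″g 1 ⟨
    coeff (h″ ⊗ g) 2  ≡⟨ shift h′ 0 ⟨
    coeff (h′ ⊗ g) 3  ≡⟨ shift h 1 ⟨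
    coeff (h ⊗ g) 4   ≡⟨ hg≈ 4 ⟩
    1ℚ                ∎

  -- Each product of normalised coefficients is regrouped around the factor `h₂ * g₂`, which equals
  -- 1; the same device gives `linear` and `constant`.
  quadratic : h₂ * g₀ + h₀ * g₂ + h₂ * g₁ * (h₁ * g₂) ≡ c
  quadratic = begin
    h₂ * g₀ + h₀ * g₂ + h₂ * g₁ * (h₁ * g₂)
      ≡⟨ solve 6 (λ g₀ g₁ g₂ h₀ h₁ h₂ →
           h₂ :* g₀ :+ h₀ :* g₂ :+ h₂ :* g₁ :* (h₁ :* g₂) :=
           h₀ :* g₂ :+ (h₁ :* g₁ :* (h₂ :* g₂) :+ h₂ :* g₀)) refl g₀ g₁ g₂ h₀ h₁ h₂ ⟩
    h₀ * g₂ + (h₁ * g₁ * (h₂ * g₂) + h₂ * g₀)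
      ≡⟨ cong (λ z → h₀ * g₂ + (z + h₂ * g₀)) (trans (cong (h₁ * g₁ *_) h₂g₂≡1) (*-identityʳ (h₁ * g₁))) ⟩
    h₀ * g₂ + (h₁ * g₁ + h₂ * g₀)
      ≡⟨ h₀g₂+h₁g₁+h₂g₀≡c ⟩
    c ∎

  linear : h₂ * g₁ * (h₀ * g₂) + h₂ * g₀ * (h₁ * g₂) ≡ d
  linear = begin
    h₂ * g₁ * (h₀ * g₂) + h₂ * g₀ * (h₁ * g₂)
      ≡⟨ solve 6 (λ g₀ g₁ g₂ h₀ h₁ h₂ →
           h₂ :* g₁ :* (h₀ :* g₂) :+ h₂ :* g₀ :* (h₁ :* g₂) :=
           (h₀ :* g₁ :+ h₁ :* g₀) :* (h₂ :* g₂)) refl g₀ g₁ g₂ h₀ h₁ h₂ ⟩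
    (h₀ * g₁ + h₁ * g₀) * (h₂ * g₂)  ≡⟨ cong₂ _*_ h₀g₁+h₁g₀≡d h₂g₂≡1 ⟩
    d * 1ℚ                           ≡⟨ *-identityʳ d ⟩
    d                                ∎

  constant : h₂ * g₀ * (h₀ * g₂) ≡ a
  constant = begin
    h₂ * g₀ * (h₀ * g₂)
      ≡⟨ solve 4 (λ g₀ g₂ h₀ h₂ → h₂ :* g₀ :* (h₀ :* g₂) := h₀ :* g₀ :* (h₂ :* g₂)) refl g₀ g₂ h₀ h₂ ⟩
    h₀ * g₀ * (h₂ * g₂)  ≡⟨ cong₂ _*_ h₀g₀≡a h₂g₂≡1 ⟩
    a * 1ℚ               ≡⟨ *-identityʳ a ⟩
    a                    ∎

-- Here the divisor is already monic, so the relation between leading coefficients forces `h₂` to be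
-- 1 and the normalised coefficients are `p` and `q` themselves. The converse multiplies the two
-- quadratics out.
∣quartic⇔ : ∀ {b c d a p q} →
  X²+ p X+ q ∣ quartic b c d a ⇔ ∃₂ (IsFactorisation b c d a p q)
∣quartic⇔ {b} {c} {d} {a} {p} {q} = mk⇔ to from
  where
  to : X²+ p X+ q ∣ quartic b c d a → ∃₂ (IsFactorisation b c d a p q)
  to (h , hg≈) =
    r , s , subst₂ (λ p q → IsFactorisation b c d a p q r s) (h₂* p) (h₂* q) (proj₂ monic)
    where
    r = coeff (tail h) 0 * 1ℚ
    s = coeff h 0 * 1ℚ
    h₂ = coeff (tail (tail h)) 0
    g-eq = X²+pX+q≡ p q
    monic = quadraticFactor⇒isFactorisation (monic₂ p q) h
      (subst (λ g → HasDegree g 2) g-eq (X²+pX+q-hasDegree p q))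
      (subst (λ g → h ⊗ g ≈ quartic b c d a) g-eq hg≈)
    h₂* : ∀ x → h₂ * x ≡ x
    h₂* x = trans (cong (_* x) (trans (sym (*-identityʳ h₂)) (proj₁ monic))) (*-identityˡ x)
  from : ∃₂ (IsFactorisation b c d a p q) → X²+ p X+ q ∣ quartic b c d a
  from (r , s , fact) = (X²+ r X+ s) , ≡⇒≈ (⊗-monic₂ fact)

hasQuadraticFactor⇔ : ∀ {b c d a} →
  HasQuadraticFactor (quartic b c d a) ⇔ (∃₂ λ p q → ∃₂ (IsFactorisation b c d a p q))
hasQuadraticFactor⇔ = mk⇔
  -- The four inferred witnesses are the coefficients of the monic multiple of `g` and of its
  -- cofactor.
  (λ (g , g-deg , h , hg≈) → _ , _ , _ , _ ,
     proj₂ (quadraticFactor⇒isFactorisation g h g-deg hg≈))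
  (λ (p , q , fact) → X²+ p X+ q , X²+pX+q-hasDegree p q , Equivalence.from ∣quartic⇔ fact)

-- Solving the coefficient equations for a given `p`.

÷-unique : ∀ {x n} d .{{_ : NonZero d}} → x * d ≡ n → x ≡ n ÷ d
÷-unique {x} {n} d xd≡n = begin
  x               ≡⟨ *-identityʳ x ⟨
  x * 1ℚ          ≡⟨ cong (x *_) (*-inverseʳ d) ⟨
  x * (d * 1/ d)  ≡⟨ *-assoc x d (1/ d) ⟨
  x * d * 1/ d    ≡⟨ cong (_* 1/ d) xd≡n ⟩
  n ÷ d           ∎

÷-* : ∀ n d .{{_ : NonZero d}} → (n ÷ d) * d ≡ n
÷-* n d = begin
  n * 1/ d * d    ≡⟨ *-assoc n (1/ d) d ⟩
  n * (1/ d * d)  ≡⟨ cong (n *_) (*-inverseˡ d) ⟩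
  n * 1ℚ          ≡⟨ *-identityʳ n ⟩
  n               ∎

*-cancelʳ : ∀ {x y} d .{{_ : NonZero d}} → x * d ≡ y * d → x ≡ y
*-cancelʳ d xd≡yd = trans (÷-unique d xd≡yd) (sym (÷-unique d refl))

-- With r = b − p: q = N / D, s = M / D and a = A / E.
record IsSolution (b c d p r D N M E A : ℚ) : Set where
  constructor isSolution
  field
    r-eq : p + r ≡ b
    D-eq : D ≡ p - r
    N-eq : N ≡ p * c - p * p * r - d
    M-eq : M ≡ (c - p * r) * D - N
    E-eq : E ≡ D * D
    A-eq : A ≡ M * N

module _ {b c d p r D N M E A : ℚ} (sol : IsSolution b c d p r D N M E A) where

  open IsSolution sol

  -- Subtracting the linear equation from `p` times the quadratic one cancels `p * s`. Nothing is
  -- divided, so the identity is also available when `D` is zero.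
  q*D≡N : ∀ {a q r′ s} → IsFactorisation b c d a p q r′ s → q * D ≡ N
  q*D≡N {q = q} {s = s} (isFactorisation p+r′≡b refl refl refl)
    -- Both `p + r′` and `p + r` equal `b`, so cancelling `p` identifies `r′` with `r`.
    with refl ← ∙-cancelˡ p _ _ (trans p+r′≡b (sym r-eq)) = begin
    q * D        ≡⟨ cong (q *_) D-eq ⟩
    q * (p - r)  ≡⟨ solve 4 (λ p q r s → q :* (p :- r) :=
                      p :* (q :+ s :+ p :* r) :- p :* p :* r :- (p :* s :+ q :* r)) refl p q r s ⟩
    p * c - p * p * r - d  ≡⟨ N-eq ⟨
    N            ∎

  s*D≡M : ∀ {a q r′ s} → IsFactorisation b c d a p q r′ s → s * D ≡ M
  s*D≡M {q = q} {s = s} fact@(isFactorisation p+r′≡b refl refl refl)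
    with refl ← ∙-cancelˡ p _ _ (trans p+r′≡b (sym r-eq)) = begin
    s * D                    ≡⟨ solve 5 (λ p q r s D → s :* D :=
                                  ((q :+ s :+ p :* r) :- p :* r) :* D :- q :* D) refl p q r s D ⟩
    (c - p * r) * D - q * D  ≡⟨ cong (λ z → (c - p * r) * D - z) (q*D≡N fact) ⟩
    (c - p * r) * D - N      ≡⟨ M-eq ⟨
    M                        ∎

  -- Serves both directions: it determines `a` from a factorization and verifies the constant
  -- equation for the quotients.
  q*s*E≡A : ∀ q s → q * D ≡ N → s * D ≡ M → q * s * E ≡ A
  q*s*E≡A q s qD≡N sD≡M = begin
    q * s * E        ≡⟨ cong (q * s *_) E-eq ⟩
    q * s * (D * D)  ≡⟨ solve 3 (λ q s D → q :* s :* (D :* D) := s :* D :* (q :* D)) refl q s D ⟩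
    s * D * (q * D)  ≡⟨ cong₂ _*_ sD≡M qD≡N ⟩
    M * N            ≡⟨ A-eq ⟨
    A                ∎

  module _ .{{_ : NonZero D}} .{{_ : NonZero E}} where

    isFactorisation⇒solution : ∀ {a q} → ∃₂ (IsFactorisation b c d a p q) → a ≡ A ÷ E × q ≡ N ÷ D
    isFactorisation⇒solution {q = q} (_ , s , fact) =
        ÷-unique E (trans (cong (_* E) (sym constant)) (q*s*E≡A q s (q*D≡N fact) (s*D≡M fact)))
      , ÷-unique D (q*D≡N fact)
      where open IsFactorisation fact

    -- The quadratic and linear equations are checked after multiplication by `D`, where the
    -- quotients enter only through `q * D` and `s * D`; then `D` is cancelled.
    solution⇒isFactorisation : ∀ {a q} → a ≡ A ÷ E → q ≡ N ÷ D →
      IsFactorisation b c d a p q r (M ÷ D)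
    solution⇒isFactorisation refl refl = isFactorisation r-eq
      (*-cancelʳ D quadratic) (*-cancelʳ D linear) (÷-unique E (q*s*E≡A q s (÷-* N D) (÷-* M D)))
      where
      q = N ÷ D
      s = M ÷ D
      quadratic : (q + s + p * r) * D ≡ c * D
      quadratic = begin
        (q + s + p * r) * D
          ≡⟨ solve 5 (λ p q r s D → (q :+ s :+ p :* r) :* D := q :* D :+ s :* D :+ p :* r :* D) refl p q r s D ⟩
        q * D + s * D + p * r * D
          ≡⟨ cong₂ (λ x y → x + y + p * r * D) (÷-* N D) (trans (÷-* M D) M-eq) ⟩
        N + ((c - p * r) * D - N) + p * r * D
          ≡⟨ solve 5 (λ c p r D N → N :+ ((c :- p :* r) :* D :- N) :+ p :* r :* D := c :* D) refl c p r D N ⟩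
        c * D ∎
      linear : (p * s + q * r) * D ≡ d * D
      linear = begin
        (p * s + q * r) * D
          ≡⟨ solve 5 (λ p q r s D → (p :* s :+ q :* r) :* D := p :* (s :* D) :+ q :* D :* r) refl p q r s D ⟩
        p * (s * D) + q * D * r
          ≡⟨ cong₂ (λ x y → p * y + x * r) (÷-* N D) (trans (÷-* M D) M-eq) ⟩
        p * ((c - p * r) * D - N) + N * r
          ≡⟨ solve 5 (λ c p r D N → p :* ((c :- p :* r) :* D :- N) :+ N :* r :=
               (p :* c :- p :* p :* r) :* D :- N :* (p :- r)) refl c p r D N ⟩
        (p * c - p * p * r) * D - N * (p - r)
          -- Expanding `N` and folding `p - r` back into `D` makes everything a multiple of `D`, in
          -- which only `d` survives.
          ≡⟨ cong₂ (λ x y → (p * c - p * p * r) * D - x * y) N-eq (sym D-eq) ⟩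
        (p * c - p * p * r) * D - (p * c - p * p * r - d) * D
          ≡⟨ solve 5 (λ c d p r D → (p :* c :- p :* p :* r) :* D :- (p :* c :- p :* p :* r :- d) :* D := d :* D) refl c d p r D ⟩
        d * D ∎

  -- Used to exclude the value of `p` at which the denominator vanishes.
  D≡0⇒N≡0 : ∀ {a q} → ∃₂ (IsFactorisation b c d a p q) → D ≡ 0ℚ → N ≡ 0ℚ
  D≡0⇒N≡0 {q = q} (_ , _ , fact) D≡0 = begin
    N       ≡⟨ q*D≡N fact ⟨
    q * D   ≡⟨ cong (q *_) D≡0 ⟩
    q * 0ℚ  ≡⟨ *-zeroʳ q ⟩
    0ℚ      ∎

-- The three families of solutions and the excluded values of `p`.

-- The parameters are the numerators and denominators exactly as displayed in the theorem; each
-- field is then a polynomial identity in `p`.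
solution₂₁ : ∀ p → IsSolution 0ℚ 1ℚ 1ℚ p (- p) (2ℚ * p)
  (p ^ 3 + p - 1ℚ) (p ^ 3 + p + 1ℚ) (4ℚ * p ^ 2) ((p ^ 3 + p - 1ℚ) * (p ^ 3 + p + 1ℚ))
solution₂₁ p = isSolution
  (+-inverseʳ p)
  (solve 1 (λ p → con 2ℚ :* p := p :- (:- p)) refl p)
  (solve 1 (λ p → p :^ 3 :+ p :- con 1ℚ := p :* con 1ℚ :- p :* p :* (:- p) :- con 1ℚ) refl p)
  (solve 1 (λ p → p :^ 3 :+ p :+ con 1ℚ :=
     (con 1ℚ :- p :* (:- p)) :* (con 2ℚ :* p) :- (p :^ 3 :+ p :- con 1ℚ)) refl p)
  (solve 1 (λ p → con 4ℚ :* p :^ 2 := con 2ℚ :* p :* (con 2ℚ :* p)) refl p)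
  (*-comm (p ^ 3 + p - 1ℚ) (p ^ 3 + p + 1ℚ))

solution₃₁ : ∀ p → IsSolution 1ℚ 0ℚ 1ℚ p (- (p - 1ℚ)) (2ℚ * p - 1ℚ)
  (p ^ 3 - p ^ 2 - 1ℚ) (p ^ 3 - 2ℚ * p ^ 2 + p + 1ℚ) ((2ℚ * p - 1ℚ) ^ 2)
  ((p ^ 3 - 2ℚ * p ^ 2 + p + 1ℚ) * (p ^ 3 - p ^ 2 - 1ℚ))
solution₃₁ p = isSolution
  (solve 1 (λ p → p :- (p :- con 1ℚ) := con 1ℚ) refl p)
  (solve 1 (λ p → con 2ℚ :* p :- con 1ℚ := p :- (:- (p :- con 1ℚ))) refl p)
  (solve 1 (λ p → p :^ 3 :- p :^ 2 :- con 1ℚ :=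
     p :* con 0ℚ :- p :* p :* (:- (p :- con 1ℚ)) :- con 1ℚ) refl p)
  (solve 1 (λ p → p :^ 3 :- con 2ℚ :* p :^ 2 :+ p :+ con 1ℚ :=
     (con 0ℚ :- p :* (:- (p :- con 1ℚ))) :* (con 2ℚ :* p :- con 1ℚ) :- (p :^ 3 :- p :^ 2 :- con 1ℚ)) refl p)
  (cong ((2ℚ * p - 1ℚ) *_) (*-identityʳ _))
  refl

solution₃₂ : ∀ p → IsSolution 1ℚ 1ℚ 0ℚ p (- (p - 1ℚ)) (2ℚ * p - 1ℚ)
  (p * (p ^ 2 - p + 1ℚ)) ((p - 1ℚ) * (p ^ 2 - p + 1ℚ)) ((2ℚ * p - 1ℚ) ^ 2)
  ((p - 1ℚ) * p * (p ^ 2 - p + 1ℚ) ^ 2)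
solution₃₂ p = isSolution
  (solve 1 (λ p → p :- (p :- con 1ℚ) := con 1ℚ) refl p)
  (solve 1 (λ p → con 2ℚ :* p :- con 1ℚ := p :- (:- (p :- con 1ℚ))) refl p)
  (solve 1 (λ p → p :* (p :^ 2 :- p :+ con 1ℚ) :=
     p :* con 1ℚ :- p :* p :* (:- (p :- con 1ℚ)) :- con 0ℚ) refl p)
  (solve 1 (λ p → (p :- con 1ℚ) :* (p :^ 2 :- p :+ con 1ℚ) :=
     (con 1ℚ :- p :* (:- (p :- con 1ℚ))) :* (con 2ℚ :* p :- con 1ℚ) :- p :* (p :^ 2 :- p :+ con 1ℚ)) refl p)
  (cong ((2ℚ * p - 1ℚ) *_) (*-identityʳ _))
  (solve 2 (λ p t → (p :- con 1ℚ) :* p :* t :^ 2 := (p :- con 1ℚ) :* t :* (p :* t)) refl p (p ^ 2 - p + 1ℚ))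

condition₂₁⇔ : ∀ {a p q} → ∃₂ (IsFactorisation 0ℚ 1ℚ 1ℚ a p q) ⇔ Condition₂₁ a p q
condition₂₁⇔ {a} {p} {q} = mk⇔ to from
  where
  to : ∃₂ (IsFactorisation 0ℚ 1ℚ 1ℚ a p q) → Condition₂₁ a p q
  to fact = p≢0 , isFactorisation⇒solution (solution₂₁ p) fact
    where
    p≢0 : p ≢ 0ℚ
    -- At `p = 0` the denominator is 0 but the numerator of `q` is -1.
    p≢0 refl = contradiction (D≡0⇒N≡0 (solution₂₁ 0ℚ) fact refl) λ ()
    instance
      _ = 2p-nonZero p≢0
      _ = 4p²-nonZero p≢0
  from : Condition₂₁ a p q → ∃₂ (IsFactorisation 0ℚ 1ℚ 1ℚ a p q)
  from (p≢0 , a≡ , q≡) = _ , _ , solution⇒isFactorisation (solution₂₁ p) a≡ q≡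
    where
    instance
      _ = 2p-nonZero p≢0
      _ = 4p²-nonZero p≢0

condition₃₁⇔ : ∀ {a p q} → ∃₂ (IsFactorisation 1ℚ 0ℚ 1ℚ a p q) ⇔ Condition₃₁ a p q
condition₃₁⇔ {a} {p} {q} = mk⇔ to from
  where
  to : ∃₂ (IsFactorisation 1ℚ 0ℚ 1ℚ a p q) → Condition₃₁ a p q
  to fact = p≢½ , isFactorisation⇒solution (solution₃₁ p) fact
    where
    p≢½ : p ≢ ½
    -- At `p = ½` the numerator of `q` is -9/8.
    p≢½ refl = contradiction (D≡0⇒N≡0 (solution₃₁ ½) fact refl) λ ()
    instance
      _ = 2p-1-nonZero p≢½
      _ = [2p-1]²-nonZero p≢½
  from : Condition₃₁ a p q → ∃₂ (IsFactorisation 1ℚ 0ℚ 1ℚ a p q)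
  from (p≢½ , a≡ , q≡) = _ , _ , solution⇒isFactorisation (solution₃₁ p) a≡ q≡
    where
    instance
      _ = 2p-1-nonZero p≢½
      _ = [2p-1]²-nonZero p≢½

condition₃₂⇔ : ∀ {a p q} → ∃₂ (IsFactorisation 1ℚ 1ℚ 0ℚ a p q) ⇔ Condition₃₂ a p q
condition₃₂⇔ {a} {p} {q} = mk⇔ to from
  where
  to : ∃₂ (IsFactorisation 1ℚ 1ℚ 0ℚ a p q) → Condition₃₂ a p q
  to fact = p≢½ , isFactorisation⇒solution (solution₃₂ p) fact
    where
    p≢½ : p ≢ ½
    -- At `p = ½` the numerator of `q` is 3/8.
    p≢½ refl = contradiction (D≡0⇒N≡0 (solution₃₂ ½) fact refl) λ ()
    instance
      _ = 2p-1-nonZero p≢½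
      _ = [2p-1]²-nonZero p≢½
  from : Condition₃₂ a p q → ∃₂ (IsFactorisation 1ℚ 1ℚ 0ℚ a p q)
  from (p≢½ , a≡ , q≡) = _ , _ , solution⇒isFactorisation (solution₃₂ p) a≡ q≡
    where
    instance
      _ = 2p-1-nonZero p≢½
      _ = [2p-1]²-nonZero p≢½

-- Transfer to divisibility, and assembly of the three cases.

module _ {P b c d a} (P≡ : P ≡ quartic b c d a) {Condition : (a p q : ℚ) → Set}
  (condition⇔ : ∀ {p q} → ∃₂ (IsFactorisation b c d a p q) ⇔ Condition a p q) where

  hasQuadraticFactor⇔condition : HasQuadraticFactor P ⇔ ∃₂ (Condition a)
  hasQuadraticFactor⇔condition rewrite P≡ = mk⇔
    (λ g → let p , q , fact = Equivalence.to hasQuadraticFactor⇔ g in p , q , Equivalence.to condition⇔ fact)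
    (λ (p , q , cond) → Equivalence.from hasQuadraticFactor⇔ (p , q , Equivalence.from condition⇔ cond))

  ∣⇔condition : ∀ {p q} → X²+ p X+ q ∣ P ⇔ Condition a p q
  ∣⇔condition rewrite P≡ = condition⇔ ⇔-∘ ∣quartic⇔

small-exponents : ∀ m k → 4 > m → m > k → k ≥ 1 →
  (m , k) ≡ (2 , 1) ⊎ (m , k) ≡ (3 , 1) ⊎ (m , k) ≡ (3 , 2)
small-exponents 2 1 _ _ _ = inj₁ refl
small-exponents 3 1 _ _ _ = inj₂ (inj₁ refl)
small-exponents 3 2 _ _ _ = inj₂ (inj₂ refl)
small-exponents m 0 _ _ ()
small-exponents 1 (suc _) _ (s≤s ()) _
small-exponents 2 (suc (suc _)) _ (s≤s (s≤s ())) _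
small-exponents 3 (suc (suc (suc _))) _ (s≤s (s≤s (s≤s ()))) _
small-exponents (suc (suc (suc (suc _)))) _ (s≤s (s≤s (s≤s (s≤s ())))) _ _

theorem2p1 :
  (m k : ℕ) → 4 > m → m > k → k ≥ 1 → (a : ℚ) →
    (HasQuadraticFactor (f 4 m k a) ⇔
      (((m , k) ≡ (2 , 1) × ∃₂ λ p q → Condition₂₁ a p q)
      ⊎ ((m , k) ≡ (3 , 1) × ∃₂ λ p q → Condition₃₁ a p q)
      ⊎ ((m , k) ≡ (3 , 2) × ∃₂ λ p q → Condition₃₂ a p q)))
    × ((m , k) ≡ (2 , 1) → (p q : ℚ) →
        (X²+ p X+ q ∣ f 4 2 1 a ⇔ Condition₂₁ a p q)
        × ((c : Condition₂₁ a p q) →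
            let instance _ = 2p-nonZero (proj₁ c) in
            f 4 2 1 a ≈
              X²+ (- p) X+ ((p ^ 3 + p + 1ℚ) ÷ (2ℚ * p))
              ⊗ X²+ p X+ ((p ^ 3 + p - 1ℚ) ÷ (2ℚ * p))))
    × ((m , k) ≡ (3 , 1) → (p q : ℚ) →
        (X²+ p X+ q ∣ f 4 3 1 a ⇔ Condition₃₁ a p q)
        × ((c : Condition₃₁ a p q) →
            let instance _ = 2p-1-nonZero (proj₁ c) in
            f 4 3 1 a ≈
              X²+ (- (p - 1ℚ)) X+ ((p ^ 3 - 2ℚ * p ^ 2 + p + 1ℚ) ÷ (2ℚ * p - 1ℚ))
              ⊗ X²+ p X+ ((p ^ 3 - p ^ 2 - 1ℚ) ÷ (2ℚ * p - 1ℚ))))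
    × ((m , k) ≡ (3 , 2) → (p q : ℚ) →
        (X²+ p X+ q ∣ f 4 3 2 a ⇔ Condition₃₂ a p q)
        × ((c : Condition₃₂ a p q) →
            let instance _ = 2p-1-nonZero (proj₁ c) in
            f 4 3 2 a ≈
              X²+ (- (p - 1ℚ)) X+ (((p - 1ℚ) * (p ^ 2 - p + 1ℚ)) ÷ (2ℚ * p - 1ℚ))
              ⊗ X²+ p X+ ((p * (p ^ 2 - p + 1ℚ)) ÷ (2ℚ * p - 1ℚ))))
theorem2p1 m k 4>m m>k k≥1 a =
    hasQuadraticFactor m k (small-exponents m k 4>m m>k k≥1)
  , (λ _ p q → ∣⇔condition (f₂₁≡ a) {Condition₂₁} condition₂₁⇔ , product₂₁)
  , (λ _ p q → ∣⇔condition (f₃₁≡ a) {Condition₃₁} condition₃₁⇔ , product₃₁)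
  , (λ _ p q → ∣⇔condition (f₃₂≡ a) {Condition₃₂} condition₃₂⇔ , product₃₂)
  where
  -- Generalising over `m` and `k` lets each `refl` fix the exponents; the other two disjuncts then
  -- equate distinct pairs of numerals.
  hasQuadraticFactor : ∀ m k → (m , k) ≡ (2 , 1) ⊎ (m , k) ≡ (3 , 1) ⊎ (m , k) ≡ (3 , 2) →
    HasQuadraticFactor (f 4 m k a) ⇔
      (((m , k) ≡ (2 , 1) × ∃₂ λ p q → Condition₂₁ a p q)
      ⊎ ((m , k) ≡ (3 , 1) × ∃₂ λ p q → Condition₃₁ a p q)
      ⊎ ((m , k) ≡ (3 , 2) × ∃₂ λ p q → Condition₃₂ a p q))
  hasQuadraticFactor _ _ (inj₁ refl) = mk⇔
    (λ g → inj₁ (refl , Equivalence.to equiv g))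
    (λ { (inj₁ (_ , cond)) → Equivalence.from equiv cond
       ; (inj₂ (inj₁ (() , _))) ; (inj₂ (inj₂ (() , _))) })
    where equiv = hasQuadraticFactor⇔condition (f₂₁≡ a) {Condition₂₁} condition₂₁⇔
  hasQuadraticFactor _ _ (inj₂ (inj₁ refl)) = mk⇔
    (λ g → inj₂ (inj₁ (refl , Equivalence.to equiv g)))
    (λ { (inj₂ (inj₁ (_ , cond))) → Equivalence.from equiv cond
       ; (inj₁ (() , _)) ; (inj₂ (inj₂ (() , _))) })
    where equiv = hasQuadraticFactor⇔condition (f₃₁≡ a) {Condition₃₁} condition₃₁⇔
  hasQuadraticFactor _ _ (inj₂ (inj₂ refl)) = mk⇔
    (λ g → inj₂ (inj₂ (refl , Equivalence.to equiv g)))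
    (λ { (inj₂ (inj₂ (_ , cond))) → Equivalence.from equiv cond
       ; (inj₁ (() , _)) ; (inj₂ (inj₁ (() , _))) })
    where equiv = hasQuadraticFactor⇔condition (f₃₂≡ a) {Condition₃₂} condition₃₂⇔

  product₂₁ : ∀ {p q} (cond : Condition₂₁ a p q) →
    let instance _ = 2p-nonZero (proj₁ cond) in
    f 4 2 1 a ≈
      X²+ (- p) X+ ((p ^ 3 + p + 1ℚ) ÷ (2ℚ * p))
      ⊗ X²+ p X+ ((p ^ 3 + p - 1ℚ) ÷ (2ℚ * p))
  product₂₁ {p} (p≢0 , a≡ , _) =
    -- Taking the displayed quotient itself as constant term of the second factor makes its equation
    -- `refl`; the other displayed quotient is `M ÷ D`.
    ≡⇒≈ (trans (f₂₁≡ a) (sym (⊗-monic₂ (solution⇒isFactorisation (solution₂₁ p) a≡ refl))))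
    where
    instance
      _ = 2p-nonZero p≢0
      _ = 4p²-nonZero p≢0

  product₃₁ : ∀ {p q} (cond : Condition₃₁ a p q) →
    let instance _ = 2p-1-nonZero (proj₁ cond) in
    f 4 3 1 a ≈
      X²+ (- (p - 1ℚ)) X+ ((p ^ 3 - 2ℚ * p ^ 2 + p + 1ℚ) ÷ (2ℚ * p - 1ℚ))
      ⊗ X²+ p X+ ((p ^ 3 - p ^ 2 - 1ℚ) ÷ (2ℚ * p - 1ℚ))
  product₃₁ {p} (p≢½ , a≡ , _) =
    ≡⇒≈ (trans (f₃₁≡ a) (sym (⊗-monic₂ (solution⇒isFactorisation (solution₃₁ p) a≡ refl))))
    where
    instance
      _ = 2p-1-nonZero p≢½
      _ = [2p-1]²-nonZero p≢½

  product₃₂ : ∀ {p q} (cond : Condition₃₂ a p q) →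
    let instance _ = 2p-1-nonZero (proj₁ cond) in
    f 4 3 2 a ≈
      X²+ (- (p - 1ℚ)) X+ (((p - 1ℚ) * (p ^ 2 - p + 1ℚ)) ÷ (2ℚ * p - 1ℚ))
      ⊗ X²+ p X+ ((p * (p ^ 2 - p + 1ℚ)) ÷ (2ℚ * p - 1ℚ))
  product₃₂ {p} (p≢½ , a≡ , _) =
    ≡⇒≈ (trans (f₃₂≡ a) (sym (⊗-monic₂ (solution⇒isFactorisation (solution₃₂ p) a≡ refl))))
    where
    instance
      _ = 2p-1-nonZero p≢½
      _ = [2p-1]²-nonZero p≢½
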